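{- Let $n\ge 1$ and let $Z$ be any finite binary string that ends in $n$ zeros and contains every binary string of length $n$ at least once as a substring. Let $V$ be the initial string of length $2^{n+1}$ of $EM_n(Z)$. Then the string $\bar 0_n V$ (that is, the $n$ zeros at the end of $Z$ followed by $V$) is a DeBruijn string of order $n+1$.
   Context: All strings are over the alphabet $\{0,1\}$; for a digit $y$, $y' = 1-y$; $\bar 0_n$ is the string of $n$ zeros. A DeBruijn string of order $m$ is a binary string of length $2^m+m-1$ that contains every binary string of length $m$ as a (contiguous) substring. Definition of $EM_n(Z)$ for $n\ge 1$ and a nonempty finite binary string $Z$: it is the infinite binary sequence $x_1x_2x_3\dots$ generated digit by digit as follows. Suppose $x_1,\dots,x_k$ ($k\ge 0$) have been generated and let $W = Zx_1\cdots x_k$ (concatenation). Let $\sigma$ be the longest tail (suffix, possibly empty) of $W$ with $|\sigma|\le n$ that also occurs as a substring of $W$ with its last digit removed. Take the latest (rightmost) such earlier occurrence and let $y$ be the digit of $W$ immediately following it; if $\sigma$ is empty, the latest previous occurrence is understood to be just before the last digit of $W$, so $y$ is the last digit of $W$. Then $x_{k+1} = y'$. The sequence $EM_n(Z)$ does not include the seed $Z$. -}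

module Defs where

open import Data.Bool.Base using (Bool; not)
open import Data.Bool.Properties using () renaming (_≟_ to _≟ᵇ_)
open import Data.List.Base
  using (List; []; _∷_; _++_; _∷ʳ_; length; applyUpTo; initLast; _∷ʳ′_)
open import Data.List.Properties
  using (++-assoc; ++-identityʳ; length-++; ∷-injectiveˡ; ∷-injectiveʳ;
         ∷ʳ-injective; applyUpTo-∷ʳ)
import Data.List.Relation.Binary.Infix.Heterogeneous as Infix
import Data.List.Relation.Binary.Infix.Heterogeneous.Properties as Infixₚ
open import Data.List.Relation.Binary.Pointwise as Pointwise using (Pointwise-≡⇒≡)
import Data.List.Relation.Binary.Prefix.Heterogeneous as Prefix
import Data.List.Relation.Binary.Suffix.Heterogeneous as Suffix
import Data.List.Relation.Binary.Suffix.Heterogeneous.Properties as Suffixₚ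
open import Data.Nat.Base
  using (ℕ; zero; suc; _+_; _∸_; _^_; _≤_; _<_; z≤n; s≤s; s≤s⁻¹)
open import Data.Nat.Induction using (<-rec)
open import Data.Nat.Properties
  using (_≟_; _≤?_; ≤-antisym; ≤-trans; ≤-reflexive; m≤n⇒m<n∨m≡n; m≤m+n;
         +-cancelʳ-≡; suc-injective)
open import Data.Product.Base using (∃; ∃-syntax; ∃₂; _×_; _,_; proj₁; proj₂)
open import Data.Sum.Base using (inj₁; inj₂)
open import Relation.Binary.PropositionalEquality
  using (_≡_; _≢_; refl; sym; trans; cong; cong₂; subst)
open import Relation.Nullary using (Dec; yes; no; contradiction)

-- The digits 0 and 1 are false and true, and y′ is not y.
BinString : Set
BinString = List Bool

infix 4 _isSubstringOf_ _isTailOf_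

_isSubstringOf_ : BinString → BinString → Set
_isSubstringOf_ = Infix.Infix _≡_

_isTailOf_ : BinString → BinString → Set
_isTailOf_ = Suffix.Suffix _≡_

ContainsAllOfLength : ℕ → BinString → Set
ContainsAllOfLength m s = ∀ w → length w ≡ m → w isSubstringOf s

DeBruijn : ℕ → BinString → Set
DeBruijn m s = length s ≡ 2 ^ m + m ∸ 1 × ContainsAllOfLength m s

RecurringTail : ℕ → BinString → BinString → Set
RecurringTail n W σ =
    σ isTailOf W
  × length σ ≤ n
  × (∃₂ λ W⁻ d → W ≡ W⁻ ∷ʳ d × σ isSubstringOf W⁻)

LongestRecurringTail : ℕ → BinString → BinString → Set
LongestRecurringTail n W σ =
    RecurringTail n W σ
  × (∀ τ → RecurringTail n W τ → length τ ≤ length σ)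

-- An occurrence of σ in W, before the last digit of W, is given by the prefix
-- p of W that ends where the occurrence ends; y is the digit following it.
OccursThen : BinString → BinString → BinString → Bool → Set
OccursThen W σ p y = σ isTailOf p × (∃[ r ] W ≡ p ++ y ∷ r)

-- When σ is empty the longest p is W without its last digit, so that y is the
-- last digit of W, as the convention for empty σ requires.
FollowsLatest : BinString → BinString → Bool → Set
FollowsLatest W σ y =
  ∃[ p ] OccursThen W σ p y × (∀ q z → OccursThen W σ q z → length q ≤ length p)

NextDigit : ℕ → BinString → Bool → Set
NextDigit n W x =
  ∃₂ λ σ y → LongestRecurringTail n W σ × FollowsLatest W σ y × x ≡ not y

-- x is the sequence EM_n(Z); the digit written x_{k+1} on paper is x k, and
-- applyUpTo x k is the string x_1 ⋯ x_k.  EM-exists and EM-unique below show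
-- that exactly one such x exists for each nonempty Z.
IsEM : ℕ → BinString → (ℕ → Bool) → Set
IsEM n Z x = ∀ k → NextDigit n (Z ++ applyUpTo x k) (x k)

private

  tail⇒≡ : ∀ {s t} → s isTailOf t → ∃[ c ] t ≡ c ++ s
  tail⇒≡ st with Suffix.toView st
  ... | c Suffix.++ eqs = c , cong (c ++_) (sym (Pointwise-≡⇒≡ eqs))

  ≡⇒tail : ∀ c {s} → s isTailOf (c ++ s)
  ≡⇒tail c = c Suffix.++ˢ Suffix.here (Pointwise.refl refl)

  ++-injective : ∀ (a b : BinString) {c d} → length a ≡ length b →
                 a ++ c ≡ b ++ d → a ≡ b × c ≡ d
  ++-injective []      []      _ e = refl , e
  ++-injective (x ∷ a) (y ∷ b) l e
    with ++-injective a b (suc-injective l) (∷-injectiveʳ e)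
  ... | a≡b , c≡d = cong₂ _∷_ (∷-injectiveˡ e) a≡b , c≡d

  tail-unique : ∀ {s t W} → s isTailOf W → t isTailOf W →
                length s ≡ length t → s ≡ t
  tail-unique {s} {t} sW tW l with tail⇒≡ sW | tail⇒≡ tW
  ... | c , refl | d , e = proj₂ (++-injective c d lc e)
    where
    lc : length c ≡ length d
    lc = +-cancelʳ-≡ (length t) _ _
      (trans (cong (length c +_) (sym l))
        (trans (sym (length-++ c)) (trans (cong length e) (length-++ d))))

  module Max {P : ℕ → Set} (P? : ∀ i → Dec (P i)) where
    max : ∀ k → (∃[ i ] i ≤ k × P i) →
          ∃[ i ] P i × (∀ j → j ≤ k → P j → j ≤ i)
    max zero    (zero , _ , p) = zero , p , λ _ j≤ _ → j≤
    max (suc k) (i , i≤ , p) with P? (suc k)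
    ... | yes q = suc k , q , λ _ j≤ _ → j≤
    ... | no ¬q = i′ , p′ , λ j j≤ pj → bound j pj (below pj j≤)
      where
      below : ∀ {j} → P j → j ≤ suc k → j ≤ k
      below pj j≤ with m≤n⇒m<n∨m≡n j≤
      ... | inj₁ j<   = s≤s⁻¹ j<
      ... | inj₂ refl = contradiction pj ¬q
      rec = max k (i , below p i≤ , p)
      i′ = proj₁ rec
      p′ = proj₁ (proj₂ rec)
      bound = λ j pj j≤ → proj₂ (proj₂ rec) j j≤ pj

  ∷ʳ-inj : ∀ (a b : BinString) {x y} → a ∷ʳ x ≡ b ∷ʳ y → a ≡ b
  ∷ʳ-inj a b e = proj₁ (∷ʳ-injective a b e)

  tailsOfLength : ∀ W ℓ → Dec (∃[ s ] s isTailOf W × length s ≡ ℓ)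
  tailsOfLength [] zero = yes ([] , ≡⇒tail [] , refl)
  tailsOfLength [] (suc ℓ) = no λ where (_ , Suffix.here Pointwise.[] , ())
  tailsOfLength (a ∷ W) ℓ with tailsOfLength W ℓ
  ... | yes (s , sW , l) = yes (s , Suffix.there sW , l)
  ... | no ¬t with length (a ∷ W) ≟ ℓ
  ... | yes l = yes (a ∷ W , ≡⇒tail [] , l)
  ... | no ¬l = no λ where
    (s , Suffix.here eqs , l) → ¬l (trans (cong length (sym (Pointwise-≡⇒≡ eqs))) l)
    (s , Suffix.there sW , l) → ¬t (s , sW , l)

  longest : ∀ n W⁻ d → ∃ (LongestRecurringTail n (W⁻ ∷ʳ d))
  longest n W⁻ d = σ , rt , λ τ rτ →
      bnd (length τ) (proj₁ (proj₂ rτ)) (τ , rτ , refl)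
    where
    W = W⁻ ∷ʳ d
    P : ℕ → Set
    P ℓ = ∃[ s ] RecurringTail n W s × length s ≡ ℓ
    P? : ∀ ℓ → Dec (P ℓ)
    P? ℓ with tailsOfLength W ℓ
    ... | no ¬t = no λ where (s , (sW , _) , l) → ¬t (s , sW , l)
    ... | yes (s , sW , refl) with length s ≤? n | Infixₚ.infix? _≟ᵇ_ s W⁻
    ... | no ¬≤ | _ = no λ where
      (t , (_ , t≤ , _) , l) → ¬≤ (≤-trans (≤-reflexive (sym l)) t≤)
    ... | yes _ | no ¬i = no λ where
      (t , (tW , _ , V , e , eq , i) , l) → ¬i
        (subst (_isSubstringOf W⁻) (tail-unique tW sW l)
          (subst (t isSubstringOf_) (sym (∷ʳ-inj W⁻ V eq)) i))
    ... | yes ≤n | yes i = yes (s , (sW , ≤n , W⁻ , d , refl , i) , refl)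
    nil : RecurringTail n W []
    nil = subst ([] isTailOf_) (++-identityʳ W) (≡⇒tail W) , z≤n , W⁻ , d , refl , Infix.here Prefix.[]
    m = Max.max P? n (0 , z≤n , [] , nil , refl)
    σ = proj₁ (proj₁ (proj₂ m))
    rt = proj₁ (proj₂ (proj₁ (proj₂ m)))
    bnd : ∀ j → j ≤ n → P j → j ≤ length σ
    bnd j j≤ pj = ≤-trans (proj₂ (proj₂ m) j j≤ pj)
      (≤-reflexive (sym (proj₂ (proj₂ (proj₁ (proj₂ m))))))

  splitAtLength : ∀ (W : BinString) i →
                  Dec (∃[ p ] ∃[ y ] ∃[ r ] W ≡ p ++ y ∷ r × length p ≡ i)
  splitAtLength [] i = no λ where
    ([] , _ , _ , () , _)
    (_ ∷ _ , _ , _ , () , _)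
  splitAtLength (a ∷ W) zero = yes ([] , a , W , refl , refl)
  splitAtLength (a ∷ W) (suc i) with splitAtLength W i
  ... | yes (p , y , r , e , l) = yes (a ∷ p , y , r , cong (a ∷_) e , cong suc l)
  ... | no ¬s = no λ where
    (b ∷ p , y , r , e , l) → ¬s (p , y , r , ∷-injectiveʳ e , suc-injective l)

  latest : ∀ W⁻ d σ → σ isSubstringOf W⁻ → ∃ (FollowsLatest (W⁻ ∷ʳ d) σ)
  latest W⁻ d σ i = y , p , occ , λ q z o →
      ≤-trans (proj₂ (proj₂ m) (length q) (short q z o) (q , z , o , refl))
        (≤-reflexive (sym (proj₂ (proj₂ (proj₂ (proj₁ (proj₂ m)))))))
    where
    W = W⁻ ∷ʳ d
    P : ℕ → Set
    P ℓ = ∃₂ λ q z → OccursThen W σ q z × length q ≡ ℓ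
    P? : ∀ ℓ → Dec (P ℓ)
    P? ℓ with splitAtLength W ℓ
    ... | no ¬s = no λ where (q , z , (_ , r , e) , l) → ¬s (q , z , r , e , l)
    ... | yes (q , z , r , e , refl) with Suffixₚ.suffix? _≟ᵇ_ σ q
    ... | yes s = yes (q , z , (s , r , e) , refl)
    ... | no ¬s = no λ where
      (q′ , _ , (s , _ , e′) , l) →
        ¬s (subst (σ isTailOf_) (proj₁ (++-injective q′ q l (trans (sym e′) e))) s)
    short : ∀ q z → OccursThen W σ q z → length q ≤ length W
    short q z (_ , r , e) = ≤-trans (m≤m+n (length q) _)
      (≤-reflexive (trans (sym (length-++ q)) (cong length (sym e))))
    split : ∀ (u : BinString) → ∃₂ λ y r → u ∷ʳ d ≡ y ∷ r
    split []      = d , [] , refl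
    split (a ∷ u) = a , u ∷ʳ d , refl
    start : ∃₂ (OccursThen W σ)
    start with Infix.toView i
    ... | Infix.MkView a {inf} eqs c with Pointwise-≡⇒≡ eqs | split c
    ... | refl | z , r , e = a ++ σ , z , ≡⇒tail a , r , eq
      where
      eq : (a ++ σ ++ c) ∷ʳ d ≡ (a ++ σ) ++ z ∷ r
      eq = trans (cong (_∷ʳ d) (sym (++-assoc a σ c)))
             (trans (++-assoc (a ++ σ) c (d ∷ [])) (cong ((a ++ σ) ++_) e))
    m = Max.max P? (length W) (_ , short _ _ (proj₂ (proj₂ start)) , _ , _ , proj₂ (proj₂ start) , refl)
    p = proj₁ (proj₁ (proj₂ m))
    y = proj₁ (proj₂ (proj₁ (proj₂ m)))
    occ = proj₁ (proj₂ (proj₂ (proj₁ (proj₂ m))))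

NextDigit-exists : ∀ n W → W ≢ [] → ∃ (NextDigit n W)
NextDigit-exists n W W≢[] with initLast W
... | [] = contradiction refl W≢[]
... | W⁻ ∷ʳ′ d with longest n W⁻ d
... | σ , lrt@((_ , _ , V , e , eq , i) , _)
  with latest W⁻ d σ (subst (σ isSubstringOf_) (sym (∷ʳ-inj W⁻ V eq)) i)
... | y , fl = not y , σ , y , lrt , fl , refl

NextDigit-unique : ∀ n W {x x′} → NextDigit n W x → NextDigit n W x′ → x ≡ x′
NextDigit-unique n W (σ , y , (rt , mx) , (p , o@(_ , r , e) , pm) , refl)
                     (σ′ , y′ , (rt′ , mx′) , (p′ , o′@(_ , r′ , e′) , pm′) , refl)
  with tail-unique (proj₁ rt) (proj₁ rt′) (≤-antisym (mx′ σ rt) (mx σ′ rt′))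
... | refl = cong not (∷-injectiveˡ (proj₂
  (++-injective p p′ (≤-antisym (pm′ p y o) (pm p′ y′ o′)) (trans (sym e) e′))))

private

  applyUpTo-cong : ∀ {x y : ℕ → Bool} k → (∀ j → j < k → x j ≡ y j) →
                   applyUpTo x k ≡ applyUpTo y k
  applyUpTo-cong zero    _ = refl
  applyUpTo-cong (suc k) h =
    cong₂ _∷_ (h 0 (s≤s z≤n)) (applyUpTo-cong k λ j j<k → h (suc j) (s≤s j<k))

  nonempty-++ : ∀ (Z U : BinString) → Z ≢ [] → Z ++ U ≢ []
  nonempty-++ []      _ Z≢[] _ = Z≢[] refl
  nonempty-++ (_ ∷ _) _ _ ()

EM-exists : ∀ n Z → Z ≢ [] → ∃ (IsEM n Z)
EM-exists n Z Z≢[] = x , λ k →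
    subst (λ u → NextDigit n (Z ++ u) (x k)) (seg k) (proj₂ (step (prefix k)))
  where
  step : ∀ u → ∃ (NextDigit n (Z ++ u))
  step u = NextDigit-exists n (Z ++ u) (nonempty-++ Z u Z≢[])
  prefix : ℕ → BinString
  prefix zero    = []
  prefix (suc k) = prefix k ∷ʳ proj₁ (step (prefix k))
  x : ℕ → Bool
  x k = proj₁ (step (prefix k))
  seg : ∀ k → prefix k ≡ applyUpTo x k
  seg zero    = refl
  seg (suc k) = trans (cong (_∷ʳ x k) (seg k)) (applyUpTo-∷ʳ x k)

EM-unique : ∀ n Z {x y} → IsEM n Z x → IsEM n Z y → ∀ k → x k ≡ y k
EM-unique n Z {x} {y} ex ey = <-rec _ λ k ih →
    NextDigit-unique n (Z ++ applyUpTo x k) (ex k)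
      (subst (λ u → NextDigit n (Z ++ u) (y k)) (sym (applyUpTo-cong k (λ j j<k → ih j<k))) (ey k))

{-# OPTIONS --safe #-}

-- Read Z x_1 x_2 ⋯ as a walk in the De Bruijn graph whose vertices are the
-- strings of length n and whose edges are those of length n + 1.  Every vertex
-- reached after the end of Z has been visited before, so the walk leaves it along
-- the edge opposite to the one last taken there.  Let q be the first time at which
-- an edge traversed since the end of Z is about to be repeated.  The vertex there
-- is visited for the third time but has only two incoming edges, so it is the
-- vertex at which Z ends, and all four edges at it have been used.  If both edges
-- out of w have been used, then so have both edges into w; and if v → w was the
-- last exit from v inside Z, then using v → w again requires, by alternation, that
-- the other edge out of v was used before it.  Following Z backwards from its end,
-- every vertex has both outgoing edges used before q.  By the pigeonhole principle
-- q comes within 2 ^ (n + 1) steps, unless these already traverse all edges.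
module Submission where

open import Defs
open import Data.Bool.Base using (Bool; true; false; not)
open import Data.Bool.Properties using (¬-not; not-¬) renaming (_≟_ to _≟ᵇ_)
open import Data.Empty using (⊥)
open import Data.Fin.Base as Fin using (Fin; toℕ; combine)
open import Data.Fin.Properties using (toℕ<n; combine-injective; pigeonhole; 2↔Bool)
open import Data.List.Base
  using ([]; _∷_; _++_; _∷ʳ_; length; replicate; applyUpTo; initLast; _∷ʳ′_)
open import Data.List.Properties
  using (≡-dec; ++-assoc; length-++; length-applyUpTo; length-replicate;
         length-++-≤ˡ; ++-identityʳ; ∷-injective; ∷-injectiveˡ;
         ∷ʳ-injectiveˡ; ∷ʳ-injectiveʳ)
import Data.List.Relation.Binary.Infix.Heterogeneous as Infix
open import Data.List.Relation.Binary.Pointwise as Pointwise using (Pointwise-≡⇒≡)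
import Data.List.Relation.Binary.Suffix.Heterogeneous as Suffix
open import Data.Nat.Base
  using (ℕ; zero; suc; _+_; _∸_; _^_; _≤_; _<_; z≤n; s≤s; s≤s⁻¹)
open import Data.Nat.Induction using (<-rec)
open import Data.Nat.Properties
open import Data.Nat.Tactic.RingSolver using (solve-∀)
open import Data.Product.Base using (∃-syntax; _×_; _,_; proj₁; proj₂)
open import Data.Sum.Base using (_⊎_; inj₁; inj₂)
open import Function.Bundles using (Inverse; Injection)
open import Function.Properties.Inverse using (↔-sym; ↔⇒↣)
open import Relation.Binary.Definitions using (tri<; tri≈; tri>)
open import Relation.Binary.PropositionalEquality
open import Relation.Nullary using (Dec; yes; no; ¬_; contradiction; _×-dec_)

-- Binary digits and the numbering of strings of fixed length

≢⇒covers : ∀ {c d : Bool} → c ≢ d → ∀ b → c ≡ b ⊎ d ≡ b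
≢⇒covers {c} c≢d b with c ≟ᵇ b
... | yes c≡b = inj₁ c≡b
... | no  c≢b = inj₂ (trans (¬-not (≢-sym c≢d)) (sym (¬-not (≢-sym c≢b))))

no-three-distinct : ∀ {b c d : Bool} → b ≢ c → c ≢ d → b ≢ d → ⊥
no-three-distinct {d = d} b≢c c≢d b≢d with ≢⇒covers b≢c d
... | inj₁ b≡d = b≢d b≡d
... | inj₂ c≡d = c≢d c≡d

encode : ∀ m (w : BinString) → length w ≡ m → Fin (2 ^ m)
encode zero    w       _   = Fin.zero
encode (suc m) (b ∷ w) |w| = combine (Inverse.from 2↔Bool b) (encode m w (suc-injective |w|))

encode-injective : ∀ m v w (|v| : length v ≡ m) (|w| : length w ≡ m) →
                   encode m v |v| ≡ encode m w |w| → v ≡ w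
encode-injective zero    []      []      _   _   _  = refl
encode-injective (suc m) (b ∷ v) (c ∷ w) |v| |w| eq
  with b≡c , v≡w ← combine-injective (Inverse.from 2↔Bool b) _ (Inverse.from 2↔Bool c) _ eq =
  cong₂ _∷_ (Injection.injective (↔⇒↣ (↔-sym 2↔Bool)) b≡c)
            (encode-injective m v w _ _ v≡w)

-- Windows of an infinite sequence

window : (ℕ → Bool) → ℕ → ℕ → BinString
window s zero    i = []
window s (suc m) i = s i ∷ window s m (suc i)

length-window : ∀ s m i → length (window s m i) ≡ m
length-window s zero    i = refl
length-window s (suc m) i = cong suc (length-window s m (suc i))

window-++ : ∀ s m k i → window s (m + k) i ≡ window s m i ++ window s k (i + m)
window-++ s zero    k i = cong (window s k) (sym (+-identityʳ i))
window-++ s (suc m) k i = cong (s i ∷_)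
  (trans (window-++ s m k (suc i))
         (cong (λ j → window s m (suc i) ++ window s k j) (sym (+-suc i m))))

window-∷ʳ : ∀ s m i → window s (suc m) i ≡ window s m i ∷ʳ s (i + m)
window-∷ʳ s m i =
  trans (cong (λ l → window s l i) (+-comm 1 m)) (window-++ s m 1 i)

window-split : ∀ s N i A {B} → window s N i ≡ A ++ B →
               A ≡ window s (length A) i × B ≡ window s (length B) (i + length A)
window-split s N i [] {B} refl =
  refl , cong₂ (window s) (sym (length-window s N i)) (sym (+-identityʳ i))
window-split s (suc N) i (b ∷ A) {B} eq
  with refl , eq′ ← ∷-injective eq
  with A≡ , B≡ ← window-split s N (suc i) A eq′ =
  cong (s i ∷_) A≡ , trans B≡ (cong (window s (length B)) (sym (+-suc i (length A))))

-- Walks that alternate between exits after time `a`, the time at which Z ends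

module AlternatingWalk
  (s : ℕ → Bool) (n a : ℕ)
  (visited : ∀ w → length w ≡ n → ∃[ i ] i ≤ a × window s n i ≡ w)
  (alternates : ∀ i → a < i →
    ∃[ j ] j < i × window s n j ≡ window s n i × s (i + n) ≡ not (s (j + n)) ×
      (∀ k → j < k → k < i → window s n k ≢ window s n i))
  where

  vertex : ℕ → BinString
  vertex = window s n

  edge : ℕ → BinString
  edge = window s (suc n)

  exit : ℕ → Bool
  exit i = s (i + n)

  edge≡vertex∷ʳexit : ∀ i → edge i ≡ vertex i ∷ʳ exit i
  edge≡vertex∷ʳexit = window-∷ʳ s n

  edge≡⇒vertex≡ : ∀ {i j} → edge i ≡ edge j → vertex i ≡ vertex j
  edge≡⇒vertex≡ {i} {j} eq = ∷ʳ-injectiveˡ (vertex i) (vertex j)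
    (trans (sym (edge≡vertex∷ʳexit i)) (trans eq (edge≡vertex∷ʳexit j)))

  edge≡⇒exit≡ : ∀ {i j} → edge i ≡ edge j → exit i ≡ exit j
  edge≡⇒exit≡ {i} {j} eq = ∷ʳ-injectiveʳ (vertex i) (vertex j)
    (trans (sym (edge≡vertex∷ʳexit i)) (trans eq (edge≡vertex∷ʳexit j)))

  -- Only times from `a` on count: these edges are the ones read off from the final zeros of Z
  -- onwards.
  Traversed : ℕ → BinString → Set
  Traversed q u = ∃[ t ] a ≤ t × t < q × edge t ≡ u

  Repeats : ℕ → Set
  Repeats q = ∃[ p ] p < q × a ≤ p × edge p ≡ edge q

  repeats? : ∀ q → Dec (Repeats q)
  repeats? q = anyUpTo? (λ p → a ≤? p ×-dec ≡-dec _≟ᵇ_ (edge p) (edge q)) q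

  -- The previous visit to the vertex of a repeated edge lies strictly between,
  -- since it was left along the opposite edge.
  alternates-after : ∀ i p → a < i → p < i → vertex p ≡ vertex i → exit p ≡ exit i →
                     ∃[ j ] p < j × j < i × vertex j ≡ vertex i × exit j ≢ exit i
  alternates-after i p a<i p<i vp≡vi ep≡ei
    with j , j<i , vj≡vi , ei≡¬ej , latest ← alternates i a<i = j , p<j , j<i , vj≡vi , ej≢ei
    where
    ej≢ei : exit j ≢ exit i
    ej≢ei ej≡ei = not-¬ (sym ej≡ei) ei≡¬ej
    p<j : p < j
    p<j with <-cmp p j
    ... | tri< p<j _ _  = p<j
    ... | tri≈ _ refl _ = contradiction ep≡ei ej≢ei
    ... | tri> _ _ j<p  = contradiction vp≡vi (latest p j<p p<i)

  -- Every edge is traversed before the first repeat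

  module FirstRepeat
    (q : ℕ) (repeats : Repeats q) (first : ∀ t → t < q → ¬ Repeats t) where

    BothOut BothIn : BinString → Set
    BothOut w = ∀ b → Traversed q (w ∷ʳ b)
    BothIn  w = ∀ b → Traversed q (b ∷ w)

    entries-differ : ∀ {t t′} → a ≤ t → t < t′ → t′ < q →
                     vertex (suc t) ≡ vertex (suc t′) → s t ≢ s t′
    entries-differ a≤t t<t′ t′<q v≡v′ e≡e′ =
      first _ t′<q (_ , t<t′ , a≤t , cong₂ _∷_ e≡e′ v≡v′)

    -- The two entering edges differ in their first digit, so they are all the edges into the
    -- vertex. `t′ ≡ q` is allowed because the edge entering at `q` is traversed at time `q ∸ 1`.
    two-arrivals : ∀ {t t′} → a < t → t < t′ → t′ ≤ q →
                   vertex t ≡ vertex t′ → BothIn (vertex t)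
    two-arrivals {suc t} {suc t′} (s≤s a≤t) (s≤s t<t′) t′<q v≡v′ b
      with ≢⇒covers (entries-differ a≤t t<t′ t′<q v≡v′) b
    ... | inj₁ refl = t  , a≤t , <-trans t<t′ t′<q , refl
    ... | inj₂ refl = t′ , ≤-trans a≤t (<⇒≤ t<t′) , t′<q , cong (s t′ ∷_) (sym v≡v′)

    two-exits : ∀ {t t′} → a ≤ t → t < q → a ≤ t′ → t′ < q →
                vertex t ≡ vertex t′ → exit t ≢ exit t′ → BothOut (vertex t)
    two-exits {t} {t′} a≤t t<q a≤t′ t′<q v≡v′ e≢e′ b with ≢⇒covers e≢e′ b
    ... | inj₁ refl = t  , a≤t  , t<q  , edge≡vertex∷ʳexit t
    ... | inj₂ refl = t′ , a≤t′ , t′<q ,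
      trans (edge≡vertex∷ʳexit t′) (cong (_∷ʳ exit t′) (sym v≡v′))

    no-third-arrival : ∀ {p j} → a < p → p < j → j < q →
                       vertex p ≡ vertex j → vertex j ≡ vertex q → ⊥
    no-third-arrival {suc p} {suc j} (s≤s a≤p) (s≤s p<j) (s≤s j<q) vp≡vj vj≡vq =
      no-three-distinct
        (entries-differ a≤p p<j (m<n⇒m<1+n j<q) vp≡vj)
        (entries-differ (≤-trans a≤p (<⇒≤ p<j)) j<q ≤-refl vj≡vq)
        (entries-differ a≤p (<-trans p<j j<q) ≤-refl (trans vp≡vj vj≡vq))

    -- The earlier traversal `p`, the visit `j` that alternation forces in between, and `q` are
    -- three visits to one vertex. If `p` came after `a`, they would need three distinct entry
    -- digits; hence `p ≡ a`.
    start-revisited : Repeats q → ∃[ j ] a < j × j < q × vertex a ≡ vertex j ×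
                                         vertex j ≡ vertex q × exit a ≢ exit j
    start-revisited (p , p<q , a≤p , eq)
      with j , p<j , j<q , vj≡vq , ej≢eq ← alternates-after q p (≤-<-trans a≤p p<q) p<q
             (edge≡⇒vertex≡ eq) (edge≡⇒exit≡ eq)
      with vp≡vj ← trans (edge≡⇒vertex≡ eq) (sym vj≡vq)
      with m≤n⇒m<n∨m≡n a≤p
    ... | inj₁ a<p  = contradiction vj≡vq (no-third-arrival a<p p<j j<q vp≡vj)
    ... | inj₂ refl = j , p<j , j<q , vp≡vj , vj≡vq ,
      λ ea≡ej → ej≢eq (trans (sym ea≡ej) (edge≡⇒exit≡ eq))

    start-in : BothIn (vertex a)
    start-in with j , a<j , j<q , va≡vj , vj≡vq , _ ← start-revisited repeats =
      subst BothIn (sym va≡vj) (two-arrivals a<j j<q ≤-refl vj≡vq)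

    start-out : BothOut (vertex a)
    start-out with j , a<j , j<q , va≡vj , _ , ea≢ej ← start-revisited repeats =
      two-exits ≤-refl (<-trans a<j j<q) (<⇒≤ a<j) j<q va≡vj ea≢ej

    -- A visit at time `a` has no counted entering edge, so that case rests on `start-in`.
    two-visits⇒BothIn : ∀ {t t′} → a ≤ t → t < t′ → t′ < q →
                        vertex t ≡ vertex t′ → BothIn (vertex t)
    two-visits⇒BothIn a≤t t<t′ t′<q v≡v′ with m≤n⇒m<n∨m≡n a≤t
    ... | inj₁ a<t  = two-arrivals a<t t<t′ (<⇒≤ t′<q) v≡v′
    ... | inj₂ refl = start-in

    -- The two outgoing edges are traversed at different times, which gives two visits to `w` before
    -- `q`.
    BothOut⇒BothIn : ∀ w → BothOut w → BothIn w
    BothOut⇒BothIn w out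
      with t₀ , a≤t₀ , t₀<q , eq₀ ← out false | t₁ , a≤t₁ , t₁<q , eq₁ ← out true
      with v₀ ← ∷ʳ-injectiveˡ _ w (trans (sym (edge≡vertex∷ʳexit t₀)) eq₀)
         | v₁ ← ∷ʳ-injectiveˡ _ w (trans (sym (edge≡vertex∷ʳexit t₁)) eq₁)
      with <-cmp t₀ t₁
    ... | tri< t₀<t₁ _ _ = subst BothIn v₀ (two-visits⇒BothIn a≤t₀ t₀<t₁ t₁<q (trans v₀ (sym v₁)))
    ... | tri> _ _ t₁<t₀ = subst BothIn v₁ (two-visits⇒BothIn a≤t₁ t₁<t₀ t₀<q (trans v₁ (sym v₀)))
    ... | tri≈ _ refl _
      with () ← ∷ʳ-injectiveʳ w w (trans (sym eq₀) eq₁)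

    -- Between the exit at `i` and its reuse at `t`, alternation forces a visit left the other way.
    -- Since `i` is the last visit up to `a`, that one comes after `a` and counts.
    last-exit-used : ∀ {i} → i < a → (∀ j → i < j → j ≤ a → vertex j ≢ vertex i) →
                     Traversed q (edge i) → BothOut (vertex i)
    last-exit-used {i} i<a last (t , a≤t , t<q , eq)
      with m≤n⇒m<n∨m≡n a≤t
    ... | inj₂ refl = contradiction (edge≡⇒vertex≡ eq) (last a i<a ≤-refl)
    ... | inj₁ a<t
      with j , i<j , j<t , vj≡vt , ej≢et ← alternates-after t i a<t (<-trans i<a a<t)
             (sym (edge≡⇒vertex≡ eq)) (sym (edge≡⇒exit≡ eq))
      with j ≤? a
    ... | yes j≤a = contradiction (trans vj≡vt (edge≡⇒vertex≡ eq)) (last j i<j j≤a)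
    ... | no  j≰a = subst BothOut (edge≡⇒vertex≡ eq)
      (two-exits a≤t t<q (<⇒≤ (≰⇒> j≰a)) (<-trans j<t t<q) (sym vj≡vt) (≢-sym ej≢et))

    -- Induction backwards from `a`, with `d` bounding the distance left. If the vertex recurs by
    -- time `a`, pass to the later visit; otherwise saturation of the next vertex supplies the edge
    -- `edge i` for `last-exit-used`.
    saturated : ∀ d {i} → i ≤ a → a ≤ d + i → BothOut (vertex i)
    saturated zero i≤a a≤i = subst (λ j → BothOut (vertex j)) (≤-antisym a≤i i≤a) start-out
    saturated (suc d) {i} i≤a a≤d+i with m≤n⇒m<n∨m≡n i≤a
    ... | inj₂ refl = start-out
    ... | inj₁ i<a
      with anyUpTo? (λ j → i <? j ×-dec ≡-dec _≟ᵇ_ (vertex j) (vertex i)) (suc a)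
    ... | yes (j , j<1+a , i<j , vj≡vi) = subst BothOut vj≡vi
      (saturated d (s≤s⁻¹ j<1+a)
        (≤-trans a≤d+i (≤-trans (≤-reflexive (sym (+-suc d i))) (+-monoʳ-≤ d i<j))))
    ... | no ¬later =
      last-exit-used i<a (λ j i<j j≤a vj≡vi → ¬later (j , s≤s j≤a , i<j , vj≡vi))
        (BothOut⇒BothIn (vertex (suc i))
          (saturated d i<a (≤-trans a≤d+i (≤-reflexive (sym (+-suc d i))))) (s i))

    all-traversed : ∀ u → length u ≡ suc n → Traversed q u
    all-traversed u |u| with initLast u
    ... | w ∷ʳ′ b
      with i , i≤a , refl ← visited w
             (suc-injective (trans (+-comm 1 _) (trans (sym (length-++ w)) |u|))) =
      saturated a i≤a (m≤m+n a i) b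

  -- Strong induction descends to the first repeat; what is traversed before it is traversed before
  -- `q`.
  repeats⇒all-traversed : ∀ q → Repeats q → ∀ u → length u ≡ suc n → Traversed q u
  repeats⇒all-traversed = <-rec _ λ q rec repeats u |u| →
    split q rec repeats u |u| (anyUpTo? repeats? q)
    where
    split : ∀ q → (∀ {t} → t < q → Repeats t → ∀ u → length u ≡ suc n → Traversed t u) →
            Repeats q → ∀ u → length u ≡ suc n → Dec (∃[ t ] t < q × Repeats t) → Traversed q u
    split q rec repeats u |u| (yes (t , t<q , repeats-t))
      with i , a≤i , i<t , eq ← rec t<q repeats-t u |u| = i , a≤i , <-trans i<t t<q , eq
    split q rec repeats u |u| (no ¬earlier) =
      FirstRepeat.all-traversed q repeats (λ t t<q r → ¬earlier (t , t<q , r)) u |u|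

  -- Pigeonhole on `u` together with the `2 ^ suc n` edges from time `a` on: either `u` is one of
  -- them, or two of them agree and a repeat occurs in time.
  traversed-in-time : ∀ u → length u ≡ suc n → Traversed (2 ^ suc n + a) u
  traversed-in-time u |u| with pigeonhole (n<1+n (2 ^ suc n)) code
    where
    code : Fin (suc (2 ^ suc n)) → Fin (2 ^ suc n)
    code Fin.zero    = encode (suc n) u |u|
    code (Fin.suc i) = encode (suc n) (edge (toℕ i + a)) (length-window s (suc n) (toℕ i + a))
  ... | Fin.zero , Fin.suc i , _ , eq =
    toℕ i + a , m≤n+m a (toℕ i) , +-monoˡ-< a (toℕ<n i) ,
    sym (encode-injective (suc n) u (edge (toℕ i + a)) |u| _ eq)
  ... | Fin.suc i , Fin.suc j , s≤s i<j , eq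
    with t , a≤t , t<q , et ← repeats⇒all-traversed (toℕ j + a)
           (toℕ i + a , +-monoˡ-< a i<j , m≤n+m a (toℕ i) ,
            encode-injective (suc n) (edge (toℕ i + a)) (edge (toℕ j + a)) _ _ eq) u |u| =
    t , a≤t , <-trans t<q (+-monoˡ-< a (toℕ<n j)) , et

-- Tails, substrings and occurrences as positions of windows

tail⇒≡ : ∀ {σ W} → σ isTailOf W → ∃[ c ] W ≡ c ++ σ
tail⇒≡ σW with Suffix.toView σW
... | c Suffix.++ eqs = c , cong (c ++_) (sym (Pointwise-≡⇒≡ eqs))

≡⇒tail : ∀ {σ W} c → W ≡ c ++ σ → σ isTailOf W
≡⇒tail c refl = Suffix.fromView (c Suffix.++ Pointwise.refl refl)

substring⇒≡ : ∀ {u W} → u isSubstringOf W → ∃[ c ] ∃[ d ] W ≡ c ++ u ++ d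
substring⇒≡ uW with Infix.toView uW
... | Infix.MkView c eqs d = c , d , cong (λ v → c ++ v ++ d) (sym (Pointwise-≡⇒≡ eqs))

≡⇒substring : ∀ {u W} c d → W ≡ c ++ u ++ d → u isSubstringOf W
≡⇒substring c d refl = Infix.fromView (Infix.MkView c (Pointwise.refl refl) d)

window-length : ∀ s N i A {B} → window s N i ≡ A ++ B → length A + length B ≡ N
window-length s N i A eq =
  trans (sym (length-++ A)) (trans (cong length (sym eq)) (length-window s N i))

window-tail : ∀ s N {σ} → σ isTailOf window s N 0 →
              ∃[ j ] j + length σ ≡ N × σ ≡ window s (length σ) j
window-tail s N σW with c , eq ← tail⇒≡ σW =
  length c , window-length s N 0 c eq , proj₂ (window-split s N 0 c eq)

window-substring : ∀ s {m N i j} → i ≤ j → j + m ≤ i + N →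
                   window s m j isSubstringOf window s N i
window-substring s {m} {N} {i} i≤j j+m≤i+N
  with d , refl ← m≤n⇒∃[o]m+o≡n i≤j
  with r , eq ← m≤n⇒∃[o]m+o≡n
         (+-cancelˡ-≤ i (d + m) N (≤-trans (≤-reflexive (sym (+-assoc i d m))) j+m≤i+N))
  with refl ← eq =
  ≡⇒substring (window s d i) (window s r (i + d + m))
    (trans (cong (λ l → window s l i) (+-assoc d m r))
      (trans (window-++ s d (m + r) i)
        (cong (window s d i ++_) (window-++ s m r (i + d)))))

substring-window : ∀ s N {u} → u isSubstringOf window s N 0 →
                   ∃[ j ] j + length u ≤ N × window s (length u) j ≡ u
substring-window s N {u} uW
  with c , d , eq ← substring⇒≡ uW
  with rest ← proj₂ (window-split s N 0 c eq) =
  length c ,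
  ≤-trans (+-monoʳ-≤ (length c) (length-++-≤ˡ u)) (≤-reflexive (window-length s N 0 c eq)) ,
  sym (proj₁ (window-split s (length (u ++ d)) (length c) u (sym rest)))

window-occurs : ∀ s n {k i} → k < i →
  OccursThen (window s (i + n) 0) (window s n k) (window s (k + n) 0) (s (k + n))
window-occurs s n {k} {i} k<i with r , refl ← m≤n⇒∃[o]m+o≡n k<i =
  ≡⇒tail (window s k 0) (window-++ s k n 0) ,
  window s r (suc (k + n)) ,
  trans (cong (λ l → window s l 0) (shuffle k r n)) (window-++ s (k + n) (suc r) 0)
  where
  shuffle : ∀ k r n → suc k + r + n ≡ k + n + suc r
  shuffle = solve-∀

occurs-window : ∀ s N {σ p y} → OccursThen (window s N 0) σ p y →
  ∃[ j ] j + length σ ≡ length p × σ ≡ window s (length σ) j × length p < N × y ≡ s (length p)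
occurs-window s N {σ} {p} {y} (σp , r , eq)
  with p≡ , y∷r≡ ← window-split s N 0 p eq
  with j , j+σ , σ≡ ← window-tail s (length p) (subst (σ isTailOf_) p≡ σp) =
  j , j+σ , σ≡ ,
  ≤-trans (m<m+n (length p) (s≤s z≤n)) (≤-reflexive (window-length s N 0 p eq)) ,
  ∷-injectiveˡ y∷r≡

-- Since the tail of full length `n` recurs, the longest recurring tail is exactly the current
-- vertex, and its latest occurrence is the latest earlier visit.
NextDigit-alternates : ∀ s n i →
  NextDigit n (window s (suc i + n) 0) (s (suc i + n)) →
  window s n (suc i) isSubstringOf window s (i + n) 0 →
  ∃[ j ] j < suc i × window s n j ≡ window s n (suc i) ×
    s (suc i + n) ≡ not (s (j + n)) ×
    (∀ k → j < k → k < suc i → window s n k ≢ window s n (suc i))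
NextDigit-alternates s n i
  (σ , y , ((σW , σ≤n , _) , longest) , (p , occ , latest) , x≡) recurs
  with ≤-antisym σ≤n
         (subst (_≤ length σ) (length-window s n (suc i))
           (longest (window s n (suc i))
             ( ≡⇒tail (window s (suc i) 0) (window-++ s (suc i) n 0)
             , ≤-reflexive (length-window s n (suc i))
             , _ , _ , window-∷ʳ s (i + n) 0 , recurs)))
... | refl
  with i′ , i′+n , σ≡ ← window-tail s (suc i + n) σW
     | j , j+n , σ≡′ , p<W , y≡ ← occurs-window s (suc i + n) occ
  with refl ← +-cancelʳ-≡ n i′ (suc i) i′+n =
  j , +-cancelʳ-< n j (suc i) (subst (_< suc i + n) (sym j+n) p<W) ,
  trans (sym σ≡′) σ≡ ,
  trans x≡ (cong not (trans y≡ (cong s (sym j+n)))) ,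
  λ k j<k k<i vk≡ → <⇒≱ j<k (+-cancelʳ-≤ n k j (subst₂ _≤_
    (length-window s (k + n) 0) (sym j+n)
    (latest (window s (k + n) 0) (s (k + n))
      (subst (λ τ → OccursThen (window s (suc i + n) 0) τ (window s (k + n) 0) (s (k + n)))
        (trans vk≡ (sym σ≡)) (window-occurs s n k<i)))))

-- Seed and generated digits as one sequence, and the conclusion

prepend : BinString → (ℕ → Bool) → ℕ → Bool
prepend []      x i       = x i
prepend (z ∷ Z) x zero    = z
prepend (z ∷ Z) x (suc i) = prepend Z x i

prepend-+ : ∀ Z x k → prepend Z x (length Z + k) ≡ x k
prepend-+ []      x k = refl
prepend-+ (z ∷ Z) x k = prepend-+ Z x k

window-suc : ∀ s m i → window s m (suc i) ≡ window (λ j → s (suc j)) m i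
window-suc s zero    i = refl
window-suc s (suc m) i = cong (s (suc i) ∷_) (window-suc s m (suc i))

window≡applyUpTo : ∀ s m → window s m 0 ≡ applyUpTo s m
window≡applyUpTo s zero    = refl
window≡applyUpTo s (suc m) =
  cong (s 0 ∷_) (trans (window-suc s m 0) (window≡applyUpTo (λ j → s (suc j)) m))

window-prepend : ∀ Z x k → window (prepend Z x) (length Z + k) 0 ≡ Z ++ applyUpTo x k
window-prepend []      x k = window≡applyUpTo x k
window-prepend (z ∷ Z) x k = cong (z ∷_)
  (trans (window-suc (prepend (z ∷ Z) x) (length Z + k) 0) (window-prepend Z x k))

theorem3p2 : ∀ (n : ℕ) → 1 ≤ n →
    ∀ (Z : BinString) →
    replicate n false isTailOf Z →
    ContainsAllOfLength n Z →
    ∀ (x : ℕ → Bool) → IsEM n Z x →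
    DeBruijn (suc n) (replicate n false ++ applyUpTo x (2 ^ suc n))
theorem3p2 n _ Z zeros all x em with c , refl ← tail⇒≡ zeros = |S|≡ , contains
  where
  K = 2 ^ suc n
  S = replicate n false ++ applyUpTo x K
  s = prepend Z x
  a = length c

  |Z|≡ : length Z ≡ a + n
  |Z|≡ = trans (length-++ c) (cong (a +_) (length-replicate n))

  Z≡ : Z ≡ window s (a + n) 0
  Z≡ = trans (sym (++-identityʳ Z)) (trans (sym (window-prepend Z x 0))
    (cong (λ l → window s l 0) (trans (+-identityʳ (length Z)) |Z|≡)))

  visited : ∀ w → length w ≡ n → ∃[ i ] i ≤ a × window s n i ≡ w
  visited w refl
    with j , j+n≤a+n , eq ← substring-window s (a + n) (subst (w isSubstringOf_) Z≡ (all w refl)) =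
    j , +-cancelʳ-≤ n j a j+n≤a+n , eq

  alternates : ∀ i → a < i →
    ∃[ j ] j < i × window s n j ≡ window s n i × s (i + n) ≡ not (s (j + n)) ×
      (∀ k → j < k → k < i → window s n k ≢ window s n i)
  alternates i a<i with k , refl ← m≤n⇒∃[o]m+o≡n a<i =
    NextDigit-alternates s n (a + k)
      (subst₂ (NextDigit n)
        (trans (sym (window-prepend Z x (suc k))) (cong (λ l → window s l 0) time))
        (trans (sym (prepend-+ Z x (suc k))) (cong s time))
        -- `Z` has length `a + n`, so `x 0` is the exit at time `a` and `x (suc k)` the exit at time
        -- `suc (a + k)`.
        (em (suc k)))
      recurs
    where
    time : length Z + suc k ≡ suc (a + k) + n
    time = trans (cong (_+ suc k) |Z|≡) (shuffle a n k)
      where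
      shuffle : ∀ a n k → a + n + suc k ≡ suc (a + k) + n
      shuffle = solve-∀
    recurs : window s n (suc (a + k)) isSubstringOf window s (a + k + n) 0
    -- Every vertex already occurs inside `Z`, hence before the last digit generated so far.
    recurs with i , i≤a , eq ← visited (window s n (suc (a + k))) (length-window s n _) =
      subst (_isSubstringOf _) eq
        (window-substring s z≤n (+-monoˡ-≤ n (≤-trans i≤a (m≤m+n a k))))

  |S|≡n+K : length S ≡ n + K
  |S|≡n+K = trans (length-++ (replicate n false))
    (cong₂ _+_ (length-replicate n) (length-applyUpTo x K))

  |S|≡ : length S ≡ K + suc n ∸ 1
  |S|≡ = trans |S|≡n+K (trans (+-comm n K) (cong (_∸ 1) (sym (+-suc K n))))

  S≡ : S ≡ window s (n + K) a
  S≡ = trans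
    (proj₂ (window-split s (length Z + K) 0 c
      (trans (window-prepend Z x K) (++-assoc c (replicate n false) (applyUpTo x K)))))
    (cong (λ l → window s l a) |S|≡n+K)

  contains : ContainsAllOfLength (suc n) S
  contains u |u|
    with t , a≤t , t<K+a , refl ← AlternatingWalk.traversed-in-time s n a visited alternates u |u| =
    subst (window s (suc n) t isSubstringOf_) (sym S≡) (window-substring s a≤t fits)
    where
    fits : t + suc n ≤ a + (n + K)
    fits = begin
      t + suc n    ≡⟨ +-suc t n ⟩
      suc t + n    ≤⟨ +-monoˡ-≤ n t<K+a ⟩
      K + a + n    ≡⟨ shuffle K a n ⟩
      a + (n + K)  ∎
      where
      open ≤-Reasoning
      shuffle : ∀ K a n → K + a + n ≡ a + (n + K)
      shuffle = solve-∀
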